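{- Let $n\ge2$ and let $X_n:\mathcal{S}_n\to\mathbb{N}_0$ be the random variable $X_n(\pi)=\mathrm{lbsum}(\pi)$, where $\mathcal{S}_n$ carries the uniform probability distribution. Then $$\mathsf{E}(X_n)=(n+1)\left(\frac n2-H_{n,1}\right)+n,$$ $$\mathrm{Var}(X_n)=2n(n+2)-(n+1)H_{n,1}-(n+1)^2H_{n,2},$$ where $H_{n,m}=1+\frac1{2^m}+\cdots+\frac1{n^m}$ is the harmonic number of order $m$.
   Context: $\mathcal{S}_n$ is the set of permutations $\pi=\pi_1\cdots\pi_n$ of $\{1,\ldots,n\}$. The left border number $a_i$ of $\pi$ is the largest position $m<i$ with $\pi_m>\pi_i$, or $0$ if no such position exists, and $\mathrm{lbsum}(\pi)=a_1+\cdots+a_n$. -}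

module Defs where

open import Data.Fin.Base using (Fin; zero; suc; toℕ; punchIn; punchOut; _<_)
open import Data.Fin.Permutation
  using (Permutation′; _≈_; _⟨$⟩ʳ_; _⟨$⟩ˡ_; inverseʳ; insert; remove;
         insert-remove; insert-punchIn)
  renaming (id to idₚ)
open import Data.Fin.Properties using (_≟_; _<?_; suc-injective)
open import Data.Integer.Base using (+_)
open import Data.List.Base
  using (List; []; _∷_; map; foldr; filter; length; allFin; cartesianProductWith)
open import Data.List.Extrema.Nat using (max)
open import Data.List.Membership.Propositional.Properties using (∈-allFin)
import Data.List.Membership.Setoid as Membership
open import Data.List.Membership.Setoid.Properties
  using (∈-resp-≈; ∈-cartesianProductWith⁺)
open import Data.List.Relation.Unary.All using ([])
open import Data.List.Relation.Unary.AllPairs using ([]; _∷_)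
open import Data.List.Relation.Unary.Any using (here)
import Data.List.Relation.Unary.Enumerates.Setoid as Enumerates
import Data.List.Relation.Unary.Unique.Propositional.Properties as Uniqueₚ
import Data.List.Relation.Unary.Unique.Setoid as Unique
import Data.List.Relation.Unary.Unique.Setoid.Properties as Uniqueₛ
open import Data.Nat.Base as ℕ using (ℕ; zero; suc; NonZero)
open import Data.Nat.ListAction using (sum)
open import Data.Nat.Properties using (m^n≢0)
open import Data.Product.Base using (_×_; _,_)
open import Data.Rational.Base using (ℚ; 0ℚ; _/_; _+_; _*_; _-_)
open import Function.Base using (_∘_)
open import Level using (0ℓ)
open import Relation.Binary.Bundles using (Setoid)
open import Relation.Binary.PropositionalEquality
  using (_≡_; refl; sym; trans; cong; setoid)
open import Relation.Nullary.Decidable using (_×-dec_; yes; no)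
open import Relation.Nullary.Negation using (contradiction)

-- Positions and values are Fin n: the number k of {1,…,n} is the element
-- with toℕ equal to k - 1, and π_i is π ⟨$⟩ʳ i.

-- a_i.  Positions are reported 1-based, so that 0 means "no such position".
leftBorder : ∀ {n} → Permutation′ n → Fin n → ℕ
leftBorder {n} π i = max 0 (map (suc ∘ toℕ) (filter larger? (allFin n)))
  where larger? = λ m → (m <? i) ×-dec ((π ⟨$⟩ʳ i) <? (π ⟨$⟩ʳ m))

lbsum : ∀ {n} → Permutation′ n → ℕ
lbsum {n} π = sum (map (leftBorder π) (allFin n))

-- Permutation′ n has no canonical listing in the library.  Each permutation of
-- suc n arises exactly once by placing the smallest value at some position of
-- a permutation of n; 𝓢-enumerates and 𝓢-unique confirm that 𝓢 n lists
-- every permutation exactly once (up to pointwise equality).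
𝓢 : ∀ n → List (Permutation′ n)
𝓢 zero    = idₚ ∷ []
𝓢 (suc n) = cartesianProductWith (λ i π → insert i zero π) (allFin (suc n)) (𝓢 n)

permutationSetoid : ℕ → Setoid 0ℓ 0ℓ
permutationSetoid n = record
  { Carrier       = Permutation′ n
  ; _≈_           = _≈_
  ; isEquivalence = record
    { refl  = λ _ → refl
    ; sym   = λ p i → sym (p i)
    ; trans = λ p q i → trans (p i) (q i)
    }
  }

insert-cong : ∀ {n} {i j : Fin (suc n)} {π ρ : Permutation′ n} →
              i ≡ j → π ≈ ρ → insert i zero π ≈ insert j zero ρ
insert-cong {i = i} refl π≈ρ k with i ≟ k
... | yes _   = refl
... | no  i≢k = cong suc (π≈ρ (punchOut i≢k))

insert-self : ∀ {n} (i : Fin (suc n)) (π : Permutation′ n) →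
              insert i zero π ⟨$⟩ʳ i ≡ zero
insert-self i π with i ≟ i
... | yes _   = refl
... | no  i≢i = contradiction refl i≢i

insert-zero : ∀ {n} (i k : Fin (suc n)) (π : Permutation′ n) →
              insert i zero π ⟨$⟩ʳ k ≡ zero → i ≡ k
insert-zero i k π eq with i ≟ k
... | yes i≡k = i≡k
... | no  _   with () ← eq

insert-injective : ∀ {n} {i j : Fin (suc n)} {π ρ : Permutation′ n} →
                   insert i zero π ≈ insert j zero ρ → i ≡ j × π ≈ ρ
insert-injective {i = i} {j} {π} {ρ} eq
  with refl ← insert-zero j i ρ (trans (sym (eq i)) (insert-self i π))
  = refl , λ k → suc-injective
      (trans (sym (insert-punchIn i zero π k))
        (trans (eq (punchIn i k)) (insert-punchIn i zero ρ k)))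

insert-remove-zero : ∀ {n} (π : Permutation′ (suc n)) →
  insert (π ⟨$⟩ˡ zero) zero (remove (π ⟨$⟩ˡ zero) π) ≈ π
insert-remove-zero π = lemma (inverseʳ π) (insert-remove (π ⟨$⟩ˡ zero) π)
  where
  lemma : ∀ {j} → j ≡ zero →
          insert (π ⟨$⟩ˡ zero) j (remove (π ⟨$⟩ˡ zero) π) ≈ π →
          insert (π ⟨$⟩ˡ zero) zero (remove (π ⟨$⟩ˡ zero) π) ≈ π
  lemma refl p = p

𝓢-enumerates : ∀ n → Enumerates.IsEnumeration (permutationSetoid n) (𝓢 n)
𝓢-enumerates zero    π = here λ ()
𝓢-enumerates (suc n) π =
  ∈-resp-≈ (permutationSetoid (suc n))
    {x = insert (π ⟨$⟩ˡ zero) zero (remove (π ⟨$⟩ˡ zero) π)} {y = π}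
    (insert-remove-zero π)
    (∈-cartesianProductWith⁺
      (setoid (Fin (suc n))) (permutationSetoid n) (permutationSetoid (suc n))
      (λ {i} {j} {ρ} {σ} → insert-cong {i = i} {j} {ρ} {σ})
      (∈-allFin (π ⟨$⟩ˡ zero)) (𝓢-enumerates n (remove (π ⟨$⟩ˡ zero) π)))

𝓢-unique : ∀ n → Unique.Unique (permutationSetoid n) (𝓢 n)
𝓢-unique zero    = [] ∷ []
𝓢-unique (suc n) = Uniqueₛ.cartesianProductWith⁺
  (setoid (Fin (suc n))) (permutationSetoid n) (permutationSetoid (suc n))
  (λ i π → insert i zero π)
  (λ {i} {j} {ρ} {σ} → insert-injective {i = i} {j} {ρ} {σ})
  (Uniqueₚ.allFin⁺ (suc n)) (𝓢-unique n)

𝓢-nonZero : ∀ n → NonZero (length (𝓢 n))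
𝓢-nonZero n = go (𝓢 n) (𝓢-enumerates n idₚ)
  where
  open Membership (permutationSetoid n) using (_∈_)
  go : ∀ πs → idₚ ∈ πs → NonZero (length πs)
  go (_ ∷ _) _ = _

fromℕ : ℕ → ℚ
fromℕ k = + k / 1

-- Expectation under the uniform distribution, P(π) = 1 / |S_n|.
𝖤 : ∀ {n} → (Permutation′ n → ℚ) → ℚ
𝖤 {n} X = foldr _+_ 0ℚ (map (λ π → X π * ((+ 1 / length (𝓢 n)) {{𝓢-nonZero n}})) (𝓢 n))

Var : ∀ {n} → (Permutation′ n → ℚ) → ℚ
Var X = 𝖤 (λ π → (X π - 𝖤 X) * (X π - 𝖤 X))

H : ℕ → ℕ → ℚ
H zero    m = 0ℚ
H (suc n) m = H n m + (+ 1 / (suc n ℕ.^ m)) {{m^n≢0 (suc n) m}}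

X : ∀ n → Permutation′ n → ℕ
X n π = lbsum π

{-# OPTIONS --safe #-}

-- For π in S_n let T_k = #{j : a_j > k} for k = 0, …, n, so that lbsum π = Σ T_k.
-- Inserting a new smallest value after the first i entries of π increments
-- T_0, …, T_{i-1} and duplicates T_i.  Hence, summed over all i, each of
--   L = Σ T_k,  M = Σ k T_k,  Q = Σ T_k²  and  L²
-- becomes a linear combination of 1, L, M, Q, L² with coefficients depending
-- only on n.  This gives recursions for the four expectations, which are solved
-- in closed form by induction on n.
module Submission where

open import Defs
open import Data.Fin.Base as Fin using (Fin; zero; suc; toℕ; inject₁; punchIn; punchOut)
open import Data.Fin.Permutation using (Permutation′; _⟨$⟩ʳ_; insert; insert-punchIn)
open import Data.Fin.Properties
  using (_≟_; _<?_; toℕ<n; toℕ-inject₁; punchIn-punchOut; punchIn-mono-≤; punchIn-cancel-≤)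
open import Data.List.Base as List
  using (List; []; _∷_; map; foldr; filter; length; allFin; cartesianProductWith)
open import Data.List.Extrema.Nat using (argmax-sel; xs≤max)
open import Data.List.Membership.Propositional.Properties
  using (∈-map⁺; ∈-map⁻; ∈-filter⁺; ∈-filter⁻; ∈-allFin)
open import Data.List.Properties using (map-tabulate; map-∘; map-cong; map-++; length-tabulate)
open import Data.List.Relation.Binary.Permutation.Propositional as Perm
  using (_↭_; prep; swap; ↭-refl)
open import Data.List.Relation.Binary.Permutation.Propositional.Properties using (map⁺)
open import Data.List.Relation.Unary.All as All using (All; []; _∷_)
import Data.List.Relation.Unary.All.Properties as All
open import Data.Nat.Base as ℕ using (ℕ; zero; suc; z≤n; s≤s)
open import Data.Nat.ListAction using (sum)
open import Data.Nat.ListAction.Properties using (sum-++)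
import Data.Nat.Properties as ℕ
open import Data.Nat.Solver renaming (module +-*-Solver to ℕ-Solver)
open import Data.Product.Base using (∃; _×_; _,_; proj₁; proj₂)
open import Data.Sum.Base using (_⊎_; inj₁; inj₂)
open import Data.Vec.Base as Vec using (Vec; []; _∷_; zipWith; replicate)
open import Function.Base using (_∘_; id)
open import Relation.Binary.PropositionalEquality
open import Relation.Nullary.Decidable using (_×-dec_; yes; no)
open import Relation.Nullary.Negation using (contradiction)
open import Algebra.Properties.CommutativeSemigroup ℕ.+-commutativeSemigroup
  using (interchange; x∙yz≈y∙xz)

-- The smallest value is the one inserted because it never serves as the larger entry for any other:
-- old borders change only through the relabelling of positions, and the new entry, all of whose
-- predecessors are larger, has border number i. An old border number grows by one exactly when it
-- exceeds i, so the new sum is L + i + T_i. This is not determined by L and i alone, which forces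
-- the whole vector T into the argument. Expanding (L + i + T_i)² and summing over i produces Σ i
-- T_i and Σ T_i²; this is where M and Q come from, and their own recursions involve nothing
-- further, so the system closes. The summation identities are proved in ℕ, with subtracted terms
-- moved to the other side and denominators 2 and 6 cleared; division enters only with the
-- expectations.

-- Left border numbers characterised by bound and attainment

LargerBefore : ∀ {n} → Permutation′ n → Fin n → Fin n → Set
LargerBefore π i m = m Fin.< i × π ⟨$⟩ʳ i Fin.< π ⟨$⟩ʳ m

-- These two properties determine `b`, so a border number can be computed by exhibiting a candidate,
-- without unfolding `max` and `filter`.
record IsLeftBorder {n} (π : Permutation′ n) (i : Fin n) (b : ℕ) : Set where
  field
    bound    : ∀ {m} → LargerBefore π i m → suc (toℕ m) ℕ.≤ b
    attained : b ≡ 0 ⊎ ∃ λ m → LargerBefore π i m × b ≡ suc (toℕ m)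

open IsLeftBorder

leftBorder-isLeftBorder : ∀ {n} (π : Permutation′ n) i → IsLeftBorder π i (leftBorder π i)
leftBorder-isLeftBorder {n} π i = record { bound = upper ; attained = reached }
  where
  larger? = λ m → (m <? i) ×-dec ((π ⟨$⟩ʳ i) <? (π ⟨$⟩ʳ m))
  positions = map (suc ∘ toℕ) (filter larger? (allFin n))

  upper : ∀ {m} → LargerBefore π i m → suc (toℕ m) ℕ.≤ leftBorder π i
  upper {m} p = All.lookup (xs≤max 0 positions)
    (∈-map⁺ (suc ∘ toℕ) (∈-filter⁺ larger? (∈-allFin m) p))

  reached : leftBorder π i ≡ 0 ⊎ ∃ λ m → LargerBefore π i m × leftBorder π i ≡ suc (toℕ m)
  reached with argmax-sel id 0 positions
  ... | inj₁ max≡0 = inj₁ max≡0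
  ... | inj₂ max∈  with ∈-map⁻ (suc ∘ toℕ) max∈
  ...   | m , m∈ , eq = inj₂ (m , proj₂ (∈-filter⁻ larger? {xs = allFin n} m∈) , eq)

isLeftBorder-≤ : ∀ {n} {π : Permutation′ n} {i b c} →
                 IsLeftBorder π i b → IsLeftBorder π i c → b ℕ.≤ c
isLeftBorder-≤ B C with attained B
... | inj₁ refl           = z≤n
... | inj₂ (m , p , refl) = bound C p

leftBorder-unique : ∀ {n} {π : Permutation′ n} {i b} → IsLeftBorder π i b → leftBorder π i ≡ b
leftBorder-unique {π = π} {i} B = ℕ.≤-antisym (isLeftBorder-≤ A B) (isLeftBorder-≤ B A)
  where A = leftBorder-isLeftBorder π i

leftBorder≤n : ∀ {n} (π : Permutation′ n) i → leftBorder π i ℕ.≤ n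
leftBorder≤n π i with attained (leftBorder-isLeftBorder π i)
... | inj₁ eq           = subst (ℕ._≤ _) (sym eq) z≤n
... | inj₂ (m , _ , eq) = subst (ℕ._≤ _) (sym eq) (toℕ<n m)

-- Border numbers after inserting the smallest value

-- Inserting the smallest value at position i turns the left border number a
-- of any other entry into bump i a.
bump : ∀ {m} → Fin m → ℕ → ℕ
bump i       zero    = zero
bump zero    (suc a) = suc (suc a)
bump (suc i) (suc a) = suc (bump i a)

bump-mono-≤ : ∀ {m} (i : Fin m) {a b} → a ℕ.≤ b → bump i a ℕ.≤ bump i b
bump-mono-≤ i       z≤n       = z≤n
bump-mono-≤ zero    (s≤s a≤b) = s≤s (s≤s a≤b)
bump-mono-≤ (suc i) (s≤s a≤b) = s≤s (bump-mono-≤ i a≤b)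

-- On 1-based positions `bump i` is the relabelling `punchIn i`; the value 0, which stands for no
-- position, is fixed by `bump`.
bump-punchIn : ∀ {m} (i : Fin (suc m)) k → bump i (suc (toℕ k)) ≡ suc (toℕ (punchIn i k))
bump-punchIn         zero    k       = refl
bump-punchIn {suc m} (suc i) zero    = refl
bump-punchIn {suc m} (suc i) (suc k) = cong suc (bump-punchIn i k)

punchIn-mono-< : ∀ {n} (i : Fin (suc n)) {j k} → j Fin.< k → punchIn i j Fin.< punchIn i k
punchIn-mono-< i {j} {k} j<k = ℕ.≰⇒> λ le → ℕ.<⇒≱ j<k (punchIn-cancel-≤ i k j le)

punchIn-cancel-< : ∀ {n} (i : Fin (suc n)) {j k} → punchIn i j Fin.< punchIn i k → j Fin.< k
punchIn-cancel-< i {j} {k} lt = ℕ.≰⇒> λ le → ℕ.<⇒≱ lt (punchIn-mono-≤ i k j le)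

data PunchInView {n} (i : Fin (suc n)) : Fin (suc n) → Set where
  here  : PunchInView i i
  there : ∀ k → PunchInView i (punchIn i k)

punchInView : ∀ {n} (i j : Fin (suc n)) → PunchInView i j
punchInView i j with i ≟ j
... | yes refl = here
... | no  i≢j  = subst (PunchInView i) (punchIn-punchOut i≢j) (there (punchOut i≢j))

-- Every earlier entry exceeds the minimum, so the border is the position immediately before i,
-- whose 1-based number is `toℕ i`. For i = 0 there is none, and the value 0 agrees with `toℕ i`
-- again.
leftBorder-insert-self : ∀ {n} (i : Fin (suc n)) (π : Permutation′ n) →
                         leftBorder (insert i zero π) i ≡ toℕ i
leftBorder-insert-self {n} i π = leftBorder-unique {π = insert i zero π}
  record { bound = proj₁ ; attained = reached i refl }
  where
  positive : ∀ {m} → i ≢ m → 0 ℕ.< toℕ (insert i zero π ⟨$⟩ʳ m)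
  positive {m} i≢m with insert i zero π ⟨$⟩ʳ m in eq
  ... | zero  = contradiction (insert-zero i m π eq) i≢m
  ... | suc _ = s≤s z≤n

  reached : ∀ j → i ≡ j → toℕ j ≡ 0 ⊎ ∃ λ m → LargerBefore (insert i zero π) j m × toℕ j ≡ suc (toℕ m)
  reached zero    _    = inj₁ refl
  reached (suc j) refl = inj₂ (inject₁ j , (before , larger) , cong suc (sym (toℕ-inject₁ j)))
    where
    before : inject₁ j Fin.< suc j
    before = s≤s (ℕ.≤-reflexive (toℕ-inject₁ j))

    larger : insert (suc j) zero π ⟨$⟩ʳ suc j Fin.< insert (suc j) zero π ⟨$⟩ʳ inject₁ j
    larger rewrite insert-self (suc j) π = positive λ eq → ℕ.<-irrefl (cong toℕ (sym eq)) before

-- The inserted minimum cannot be a larger entry, so the candidates are exactly the relabelled old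
-- ones. Relabelling preserves the order of positions, hence also which candidate is last.
leftBorder-insert-punchIn : ∀ {n} (i : Fin (suc n)) (π : Permutation′ n) j →
  leftBorder (insert i zero π) (punchIn i j) ≡ bump i (leftBorder π j)
leftBorder-insert-punchIn {n} i π j = leftBorder-unique {π = insert i zero π}
  record { bound = upper _ ; attained = reached }
  where
  π′ = insert i zero π
  B  = leftBorder-isLeftBorder π j

  value : ∀ k → π′ ⟨$⟩ʳ punchIn i k ≡ suc (π ⟨$⟩ʳ k)
  value = insert-punchIn i zero π

  upper : ∀ m → LargerBefore π′ (punchIn i j) m → suc (toℕ m) ℕ.≤ bump i (leftBorder π j)
  upper m p with punchInView i m
  -- At the inserted position the value is `zero`, and nothing lies below it.
  upper m (_ , π′j<π′m) | here rewrite insert-self i π = contradiction π′j<π′m λ ()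
  upper m (m<j , π′j<π′m) | there k = subst (ℕ._≤ _) (bump-punchIn i k)
    (bump-mono-≤ i (bound B
      ( punchIn-cancel-< i m<j
      , ℕ.s<s⁻¹ (subst₂ Fin._<_ (value j) (value k) π′j<π′m))))

  reached : bump i (leftBorder π j) ≡ 0 ⊎
            ∃ λ m → LargerBefore π′ (punchIn i j) m × bump i (leftBorder π j) ≡ suc (toℕ m)
  reached with attained B
  ... | inj₁ eq = inj₁ (cong (bump i) eq)
  ... | inj₂ (k , (k<j , πj<πk) , eq) = inj₂
    ( punchIn i k
    , (punchIn-mono-< i k<j , subst₂ Fin._<_ (sym (value j)) (sym (value k)) (s≤s πj<πk))
    , trans (cong (bump i) eq) (bump-punchIn i k))

-- The multiset of border numbers under insertion

borders : ∀ {n} → Permutation′ n → List ℕ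
borders {n} π = map (leftBorder π) (allFin n)

allFin-suc : ∀ n → allFin (suc n) ≡ zero ∷ map suc (allFin n)
allFin-suc n = cong (zero ∷_) (sym (map-tabulate id suc))

-- Bringing the inserted position to the front costs a reordering, so only statistics insensitive to
-- order, such as the profile, carry over along it.
allFin-punchIn : ∀ {n} (i : Fin (suc n)) → allFin (suc n) ↭ i ∷ map (punchIn i) (allFin n)
allFin-punchIn {n} zero = Perm.↭-reflexive (allFin-suc n)
allFin-punchIn {suc n} (suc i) = begin
  allFin (suc (suc n))                                    ≡⟨ allFin-suc (suc n) ⟩
  zero ∷ map suc (allFin (suc n))                         ↭⟨ prep zero (map⁺ suc (allFin-punchIn i)) ⟩
  zero ∷ suc i ∷ map suc (map (punchIn i) (allFin n))     ↭⟨ swap zero (suc i) ↭-refl ⟩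
  -- `punchIn (suc i) ∘ suc` and `suc ∘ punchIn i` agree by definition, so the two uses of `map-∘`
  -- meet in the middle.
  suc i ∷ zero ∷ map suc (map (punchIn i) (allFin n))     ≡⟨ cong (λ xs → suc i ∷ zero ∷ xs) (trans (sym (map-∘ (allFin n))) (map-∘ (allFin n))) ⟩
  suc i ∷ map (punchIn (suc i)) (zero ∷ map suc (allFin n)) ≡⟨ cong (λ xs → suc i ∷ map (punchIn (suc i)) xs) (allFin-suc n) ⟨
  suc i ∷ map (punchIn (suc i)) (allFin (suc n))          ∎
  where open Perm.PermutationReasoning

borders-insert : ∀ {n} (i : Fin (suc n)) (π : Permutation′ n) →
                 borders (insert i zero π) ↭ toℕ i ∷ map (bump i) (borders π)
borders-insert {n} i π = begin
  map b′ (allFin (suc n))                          ↭⟨ map⁺ b′ (allFin-punchIn i) ⟩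
  b′ i ∷ map b′ (map (punchIn i) (allFin n))       ≡⟨ cong₂ _∷_ (leftBorder-insert-self i π) shifted ⟩
  toℕ i ∷ map (bump i) (map (leftBorder π) (allFin n)) ∎
  where
  open Perm.PermutationReasoning
  b′ = leftBorder (insert i zero π)
  shifted : map b′ (map (punchIn i) (allFin n)) ≡ map (bump i) (map (leftBorder π) (allFin n))
  shifted = trans (sym (map-∘ (allFin n)))
    (trans (map-cong (leftBorder-insert-punchIn i π) (allFin n)) (map-∘ (allFin n)))

-- Profiles and the effect of insertion on them

infixl 6 _⊕_
_⊕_ : ∀ {m} → Vec ℕ m → Vec ℕ m → Vec ℕ m
_⊕_ = zipWith ℕ._+_

zeros : ∀ {m} → Vec ℕ m
zeros = replicate _ 0

-- The indicator vector of k < a, cut off at length m. A sum of such vectors is, apart from the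
-- cut-off and trailing zeros, the conjugate partition.
staircase : ∀ m → ℕ → Vec ℕ m
staircase zero    a       = []
staircase (suc m) zero    = 0 ∷ staircase m 0
staircase (suc m) (suc a) = 1 ∷ staircase m a

-- Entry k of the profile counts the elements of the list exceeding k.
profile : ∀ m → List ℕ → Vec ℕ m
profile m []       = zeros
profile m (a ∷ as) = staircase m a ⊕ profile m as

⊕-swap : ∀ {m} (u v w : Vec ℕ m) → u ⊕ (v ⊕ w) ≡ v ⊕ (u ⊕ w)
⊕-swap []      []      []      = refl
⊕-swap (x ∷ u) (y ∷ v) (z ∷ w) = cong₂ _∷_ (x∙yz≈y∙xz x y z) (⊕-swap u v w)

profile-↭ : ∀ m {as bs} → as ↭ bs → profile m as ≡ profile m bs
profile-↭ m _↭_.refl        = refl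
profile-↭ m (prep a p)      = cong (staircase m a ⊕_) (profile-↭ m p)
profile-↭ m (swap a b p)    = trans (⊕-swap (staircase m a) (staircase m b) _)
  (cong (λ v → staircase m b ⊕ (staircase m a ⊕ v)) (profile-↭ m p))
profile-↭ m (_↭_.trans p q) = trans (profile-↭ m p) (profile-↭ m q)

duplicate : ∀ {m} → Fin m → Vec ℕ m → Vec ℕ (suc m)
duplicate zero    (x ∷ v) = x ∷ x ∷ v
duplicate (suc i) (x ∷ v) = x ∷ duplicate i v

-- The effect on the profile of inserting the smallest value at position i:
-- the new entry has toℕ i as left border number, the others are bumped.
ins : ∀ {m} → Fin m → Vec ℕ m → Vec ℕ (suc m)
ins zero    (x ∷ v) = x ∷ x ∷ v
ins (suc i) (x ∷ v) = suc x ∷ ins i v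

staircase-0-⊕ : ∀ {m} (v : Vec ℕ m) → staircase m 0 ⊕ v ≡ v
staircase-0-⊕ []      = refl
staircase-0-⊕ (x ∷ v) = cong (x ∷_) (staircase-0-⊕ v)

ins-⊕ : ∀ {m} (i : Fin m) v → ins i v ≡ staircase (suc m) (toℕ i) ⊕ duplicate i v
ins-⊕ zero    (x ∷ v) = cong (λ w → x ∷ x ∷ w) (sym (staircase-0-⊕ v))
ins-⊕ (suc i) (x ∷ v) = cong (suc x ∷_) (ins-⊕ i v)

duplicate-zeros : ∀ {m} (i : Fin m) → duplicate i zeros ≡ zeros
duplicate-zeros zero    = refl
duplicate-zeros (suc i) = cong (0 ∷_) (duplicate-zeros i)

duplicate-⊕ : ∀ {m} (i : Fin m) u v → duplicate i (u ⊕ v) ≡ duplicate i u ⊕ duplicate i v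
duplicate-⊕ zero    (x ∷ u) (y ∷ v) = refl
duplicate-⊕ (suc i) (x ∷ u) (y ∷ v) = cong (x ℕ.+ y ∷_) (duplicate-⊕ i u v)

-- Entry i of the staircase is 1 exactly when a > i, which is exactly when `bump i` raises a;
-- duplicating that entry thus adds a 1 precisely in this case.
duplicate-staircase : ∀ {m} (i : Fin m) a → duplicate i (staircase m a) ≡ staircase (suc m) (bump i a)
duplicate-staircase zero    zero    = refl
duplicate-staircase zero    (suc a) = refl
duplicate-staircase (suc i) zero    = cong (0 ∷_) (duplicate-staircase i 0)
duplicate-staircase (suc i) (suc a) = cong (1 ∷_) (duplicate-staircase i a)

duplicate-profile : ∀ {m} (i : Fin m) as →
                    duplicate i (profile m as) ≡ profile (suc m) (map (bump i) as)
duplicate-profile i []       = duplicate-zeros i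
duplicate-profile {m} i (a ∷ as) = trans (duplicate-⊕ i (staircase m a) (profile m as))
  (cong₂ _⊕_ (duplicate-staircase i a) (duplicate-profile i as))

-- Length `suc n` gives one entry for each of the n + 1 insertion positions, including the one
-- behind the last entry.
borderProfile : ∀ {n} → Permutation′ n → Vec ℕ (suc n)
borderProfile {n} π = profile (suc n) (borders π)

borderProfile-insert : ∀ {n} (i : Fin (suc n)) (π : Permutation′ n) →
                       borderProfile (insert i zero π) ≡ ins i (borderProfile π)
borderProfile-insert {n} i π = begin
  profile (2 ℕ.+ n) (borders (insert i zero π))             ≡⟨ profile-↭ (2 ℕ.+ n) (borders-insert i π) ⟩
  staircase (2 ℕ.+ n) (toℕ i) ⊕ profile (2 ℕ.+ n) (map (bump i) (borders π))
    ≡⟨ cong (staircase (2 ℕ.+ n) (toℕ i) ⊕_) (duplicate-profile i (borders π)) ⟨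
  staircase (2 ℕ.+ n) (toℕ i) ⊕ duplicate i (borderProfile π) ≡⟨ ins-⊕ i (borderProfile π) ⟨
  ins i (borderProfile π)                                    ∎
  where open ≡-Reasoning

sum-⊕ : ∀ {m} (u v : Vec ℕ m) → Vec.sum (u ⊕ v) ≡ Vec.sum u ℕ.+ Vec.sum v
sum-⊕ []      []      = refl
sum-⊕ (x ∷ u) (y ∷ v) = trans (cong (x ℕ.+ y ℕ.+_) (sum-⊕ u v))
  (interchange x y (Vec.sum u) (Vec.sum v))

sum-staircase : ∀ m {a} → a ℕ.≤ m → Vec.sum (staircase m a) ≡ a
sum-staircase zero    z≤n       = refl
sum-staircase (suc m) z≤n       = sum-staircase m z≤n
sum-staircase (suc m) (s≤s a≤m) = cong suc (sum-staircase m a≤m)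

sum-zeros : ∀ m → Vec.sum (zeros {m}) ≡ 0
sum-zeros zero    = refl
sum-zeros (suc m) = sum-zeros m

-- Summation by levels; the bound m ensures that no staircase is cut off.
sum-profile : ∀ m {as} → All (ℕ._≤ m) as → Vec.sum (profile m as) ≡ sum as
sum-profile m []                       = sum-zeros m
sum-profile m {a ∷ as} (a≤m ∷ as≤m) = trans (sum-⊕ (staircase m a) (profile m as))
  (cong₂ ℕ._+_ (sum-staircase m a≤m) (sum-profile m as≤m))

sum-borderProfile : ∀ {n} (π : Permutation′ n) → Vec.sum (borderProfile π) ≡ lbsum π
sum-borderProfile {n} π = sum-profile (suc n)
  (All.map⁺ (All.tabulate⁺ λ i → ℕ.m≤n⇒m≤1+n (leftBorder≤n π i)))

-- Sums over all insertion positions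

private variable
  S T U : Set

module _ where
  open import Data.Nat.Base using (_+_; _*_)

  sum-map-+ : ∀ (f g : S → ℕ) xs → sum (map (λ x → f x + g x) xs) ≡ sum (map f xs) + sum (map g xs)
  sum-map-+ f g []       = refl
  sum-map-+ f g (x ∷ xs) = trans (cong (f x + g x +_) (sum-map-+ f g xs)) (interchange (f x) (g x) _ _)

  sum-map-cartesianProductWith : ∀ (g : U → ℕ) (f : S → T → U) xs ys →
    sum (map g (cartesianProductWith f xs ys)) ≡ sum (map (λ y → sum (map (λ x → g (f x y)) xs)) ys)
  sum-map-cartesianProductWith g f [] ys = sym (zero-sum ys)
    where
    zero-sum : ∀ ys → sum (map (λ _ → 0) ys) ≡ 0
    zero-sum []       = refl
    zero-sum (_ ∷ ys) = zero-sum ys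
  sum-map-cartesianProductWith g f (x ∷ xs) ys = begin
    sum (map g (map (f x) ys List.++ cartesianProductWith f xs ys))
      ≡⟨ cong sum (map-++ g (map (f x) ys) _) ⟩
    sum (map g (map (f x) ys) List.++ map g (cartesianProductWith f xs ys))
      ≡⟨ sum-++ (map g (map (f x) ys)) _ ⟩
    sum (map g (map (f x) ys)) + sum (map g (cartesianProductWith f xs ys))
      ≡⟨ cong₂ _+_ (cong sum (sym (map-∘ ys))) (sum-map-cartesianProductWith g f xs ys) ⟩
    sum (map (g ∘ f x) ys) + sum (map (λ y → sum (map (λ x → g (f x y)) xs)) ys)
      ≡⟨ sum-map-+ (g ∘ f x) _ ys ⟨
    sum (map (λ y → g (f x y) + sum (map (λ x → g (f x y)) xs)) ys) ∎
    where open ≡-Reasoning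

  -- The sum of f over all insertions into v, arranged for induction on v: position 0 duplicates the
  -- head, and every later position increments it, which is absorbed into f as the prefix `suc x`.
  insSum : ∀ {m} → (Vec ℕ (suc m) → ℕ) → Vec ℕ m → ℕ
  insSum f []      = 0
  insSum f (x ∷ v) = f (x ∷ x ∷ v) + insSum (f ∘ (suc x ∷_)) v

  sum-ins : ∀ {m} (f : Vec ℕ (suc m) → ℕ) v → sum (map (λ i → f (ins i v)) (allFin m)) ≡ insSum f v
  sum-ins f []                = refl
  sum-ins {suc m} f (x ∷ v) = cong (f (x ∷ x ∷ v) +_) (begin
    sum (map F (List.tabulate suc))                    ≡⟨ cong (λ is → sum (map F is)) (map-tabulate id suc) ⟨
    sum (map F (map suc (allFin m)))                   ≡⟨ cong sum (map-∘ (allFin m)) ⟨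
    sum (map (F ∘ suc) (allFin m))                     ≡⟨ sum-ins (f ∘ (suc x ∷_)) v ⟩
    insSum (f ∘ (suc x ∷_)) v                          ∎)
    where
    open ≡-Reasoning
    F : Fin (suc m) → ℕ
    F i = f (ins i (x ∷ v))

  insSum-cong : ∀ {m} {f g : Vec ℕ (suc m) → ℕ} → (∀ w → f w ≡ g w) → ∀ v → insSum f v ≡ insSum g v
  insSum-cong f≗g []      = refl
  insSum-cong f≗g (x ∷ v) = cong₂ _+_ (f≗g (x ∷ x ∷ v)) (insSum-cong (f≗g ∘ (suc x ∷_)) v)

  insSum-+ : ∀ {m} (f g : Vec ℕ (suc m) → ℕ) v → insSum (λ w → f w + g w) v ≡ insSum f v + insSum g v
  insSum-+ f g []      = refl
  insSum-+ f g (x ∷ v) = trans (cong (f xxv + g xxv +_) (insSum-+ (f ∘ (suc x ∷_)) (g ∘ (suc x ∷_)) v))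
    (interchange (f xxv) (g xxv) _ _)
    where xxv = x ∷ x ∷ v

  insSum-* : ∀ {m} c (f : Vec ℕ (suc m) → ℕ) v → insSum (λ w → c * f w) v ≡ c * insSum f v
  insSum-* c f []      = sym (ℕ.*-zeroʳ c)
  insSum-* c f (x ∷ v) = trans (cong (c * f (x ∷ x ∷ v) +_) (insSum-* c (f ∘ (suc x ∷_)) v))
    (sym (ℕ.*-distribˡ-+ c (f (x ∷ x ∷ v)) _))

  insSum-const : ∀ {m} c (v : Vec ℕ m) → insSum (λ _ → c) v ≡ m * c
  insSum-const c []      = refl
  insSum-const c (x ∷ v) = cong (c +_) (insSum-const c v)

  sumSq : ∀ {m} → Vec ℕ m → ℕ
  sumSq []      = 0
  sumSq (x ∷ v) = x * x + sumSq v

  -- Σ k · v_k, counting entries from 0.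
  moment : ∀ {m} → Vec ℕ m → ℕ
  moment []      = 0
  moment (x ∷ v) = moment v + Vec.sum v

  sqSum : ∀ {m} → Vec ℕ m → ℕ
  sqSum v = Vec.sum v * Vec.sum v

  -- Insertion at i adds i + T_i to the sum. Over all i < m this totals m(m-1)/2 plus one further
  -- copy of the sum.
  insSum-sum : ∀ {m} (v : Vec ℕ m) →
    2 * insSum Vec.sum v + m ≡ 2 * (suc m * Vec.sum v) + m * m
  insSum-sum []                = refl
  insSum-sum {suc m} (x ∷ v) = begin
    2 * (x + (x + l) + insSum (λ w → suc x + Vec.sum w) v) + suc m
      ≡⟨ cong (λ t → 2 * (x + (x + l) + t) + suc m)
           (trans (insSum-+ (λ _ → suc x) Vec.sum v) (cong (_+ A) (insSum-const (suc x) v))) ⟩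
    2 * (x + (x + l) + (m * suc x + A)) + suc m
      ≡⟨ solve 4 (λ x l m A → con 2 :* (x :+ (x :+ l) :+ (m :* (con 1 :+ x) :+ A)) :+ (con 1 :+ m)
                   := (con 2 :* A :+ m) :+ (con 2 :* (x :+ (x :+ l) :+ m :* (con 1 :+ x)) :+ con 1)) refl x l m A ⟩
    (2 * A + m) + (2 * (x + (x + l) + m * suc x) + 1)
      ≡⟨ cong₂ _+_ (insSum-sum v) refl ⟩
    (2 * (suc m * l) + m * m) + (2 * (x + (x + l) + m * suc x) + 1)
      ≡⟨ solve 3 (λ x l m → (con 2 :* ((con 1 :+ m) :* l) :+ m :* m) :+ (con 2 :* (x :+ (x :+ l) :+ m :* (con 1 :+ x)) :+ con 1)
                   := con 2 :* ((con 2 :+ m) :* (x :+ l)) :+ (con 1 :+ m) :* (con 1 :+ m)) refl x l m ⟩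
    2 * (suc (suc m) * (x + l)) + suc m * suc m ∎
    where
    open ≡-Reasoning
    open ℕ-Solver
    l = Vec.sum v
    A = insSum Vec.sum v

  -- Insertion at i adds i T_i + Σ_{k≥i} T_k + i(i-1)/2 to the moment: the entries from T_i on move
  -- one place to the right, a copy of T_i stays, and the increments at k < i contribute Σ k.
  insSum-moment : ∀ {m} (v : Vec ℕ m) →
    6 * insSum moment v + 3 * (m * m) ≡ 6 * ((2 + m) * moment v) + 6 * Vec.sum v + m * (m * m) + 2 * m
  insSum-moment []                = refl
  insSum-moment {suc m} (x ∷ v) = begin
    6 * (M + l + (x + l) + insSum (λ w → moment w + Vec.sum w) v) + 3 * (suc m * suc m)
      -- The prefixed head has weight 0 but shifts the tail, so the moment gains the tail's sum;
      -- three copies of `insSum-sum` account for it.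
      ≡⟨ cong (λ t → 6 * (M + l + (x + l) + t) + 3 * (suc m * suc m)) (insSum-+ moment Vec.sum v) ⟩
    6 * (M + l + (x + l) + (B + A)) + 3 * (suc m * suc m)
      ≡⟨ solve 6 (λ x l m M A B → con 6 :* (M :+ l :+ (x :+ l) :+ (B :+ A)) :+ con 3 :* ((con 1 :+ m) :* (con 1 :+ m))
           := (con 6 :* B :+ con 3 :* (m :* m)) :+ con 3 :* (con 2 :* A :+ m)
              :+ (con 3 :* m :+ con 3 :+ con 6 :* M :+ con 12 :* l :+ con 6 :* x)) refl x l m M A B ⟩
    (6 * B + 3 * (m * m)) + 3 * (2 * A + m) + (3 * m + 3 + 6 * M + 12 * l + 6 * x)
      ≡⟨ cong₂ _+_ (cong₂ (λ s t → s + 3 * t) (insSum-moment v) (insSum-sum v)) refl ⟩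
    (6 * ((2 + m) * M) + 6 * l + m * (m * m) + 2 * m) + 3 * (2 * (suc m * l) + m * m) + (3 * m + 3 + 6 * M + 12 * l + 6 * x)
      ≡⟨ solve 4 (λ x l m M → (con 6 :* ((con 2 :+ m) :* M) :+ con 6 :* l :+ m :* (m :* m) :+ con 2 :* m)
              :+ con 3 :* (con 2 :* ((con 1 :+ m) :* l) :+ m :* m)
              :+ (con 3 :* m :+ con 3 :+ con 6 :* M :+ con 12 :* l :+ con 6 :* x)
           := con 6 :* ((con 3 :+ m) :* (M :+ l)) :+ con 6 :* (x :+ l)
              :+ (con 1 :+ m) :* ((con 1 :+ m) :* (con 1 :+ m)) :+ con 2 :* (con 1 :+ m)) refl x l m M ⟩
    6 * ((3 + m) * (M + l)) + 6 * (x + l) + suc m * (suc m * suc m) + 2 * suc m ∎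
    where
    open ≡-Reasoning
    open ℕ-Solver
    l = Vec.sum v
    M = moment v
    A = insSum Vec.sum v
    B = insSum moment v

  -- Insertion at i adds T_i² + Σ_{k<i} (2 T_k + 1). Exchanging the order of summation gives T_k the
  -- factor 2(m - 1 - k), the source of the moment.
  insSum-sumSq : ∀ {m} (v : Vec ℕ m) →
    2 * insSum sumSq v + 4 * moment v + 4 * Vec.sum v + m ≡ 2 * (suc m * sumSq v) + 4 * (m * Vec.sum v) + m * m
  insSum-sumSq []                = refl
  insSum-sumSq {suc m} (x ∷ v) = begin
    2 * (x * x + (x * x + q) + insSum (λ w → suc x * suc x + sumSq w) v) + 4 * (M + l) + 4 * (x + l) + suc m
      ≡⟨ cong (λ t → 2 * (x * x + (x * x + q) + t) + 4 * (M + l) + 4 * (x + l) + suc m)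
           (trans (insSum-+ (λ _ → suc x * suc x) sumSq v) (cong (_+ D) (insSum-const (suc x * suc x) v))) ⟩
    2 * (x * x + (x * x + q) + (m * (suc x * suc x) + D)) + 4 * (M + l) + 4 * (x + l) + suc m
      ≡⟨ solve 6 (λ x l m M q D →
              con 2 :* (x :* x :+ (x :* x :+ q) :+ (m :* ((con 1 :+ x) :* (con 1 :+ x)) :+ D))
              :+ con 4 :* (M :+ l) :+ con 4 :* (x :+ l) :+ (con 1 :+ m)
           := (con 2 :* D :+ con 4 :* M :+ con 4 :* l :+ m)
              :+ (con 4 :* (x :* x) :+ con 2 :* q :+ con 2 :* (m :* ((con 1 :+ x) :* (con 1 :+ x))) :+ con 4 :* l :+ con 4 :* x :+ con 1))
           refl x l m M q D ⟩
    (2 * D + 4 * M + 4 * l + m) + (4 * (x * x) + 2 * q + 2 * (m * (suc x * suc x)) + 4 * l + 4 * x + 1)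
      ≡⟨ cong₂ _+_ (insSum-sumSq v) refl ⟩
    (2 * (suc m * q) + 4 * (m * l) + m * m) + (4 * (x * x) + 2 * q + 2 * (m * (suc x * suc x)) + 4 * l + 4 * x + 1)
      ≡⟨ solve 4 (λ x l m q →
              (con 2 :* ((con 1 :+ m) :* q) :+ con 4 :* (m :* l) :+ m :* m)
              :+ (con 4 :* (x :* x) :+ con 2 :* q :+ con 2 :* (m :* ((con 1 :+ x) :* (con 1 :+ x))) :+ con 4 :* l :+ con 4 :* x :+ con 1)
           := con 2 :* ((con 2 :+ m) :* (x :* x :+ q)) :+ con 4 :* ((con 1 :+ m) :* (x :+ l)) :+ (con 1 :+ m) :* (con 1 :+ m))
           refl x l m q ⟩
    2 * (suc (suc m) * (x * x + q)) + 4 * (suc m * (x + l)) + suc m * suc m ∎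
    where
    open ≡-Reasoning
    open ℕ-Solver
    l = Vec.sum v
    M = moment v
    q = sumSq v
    D = insSum sumSq v

  -- This is the sum over i of (L + i + T_i)²: the cross terms i T_i give the moment, and the
  -- squares T_i² give `sumSq`.
  insSum-sqSum : ∀ {m} (v : Vec ℕ m) →
    6 * insSum sqSum v + 6 * (m * Vec.sum v) + 3 * (m * m)
    ≡ 6 * ((2 + m) * sqSum v) + 6 * (m * m * Vec.sum v) + 12 * moment v + 6 * sumSq v + 2 * (m * (m * m)) + m
  insSum-sqSum []                = refl
  insSum-sqSum {suc m} (x ∷ v) = begin
    6 * (xxl * xxl + insSum (λ w → (suc x + Vec.sum w) * (suc x + Vec.sum w)) v) + 6 * (suc m * (x + l)) + 3 * (suc m * suc m)
      ≡⟨ cong (λ t → 6 * (xxl * xxl + t) + 6 * (suc m * (x + l)) + 3 * (suc m * suc m)) expand ⟩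
    6 * (xxl * xxl + (m * (suc x * suc x) + 2 * suc x * A + E)) + 6 * (suc m * (x + l)) + 3 * (suc m * suc m)
      ≡⟨ solve 5 (λ x l m A E →
              con 6 :* ((x :+ (x :+ l)) :* (x :+ (x :+ l)) :+ (m :* ((con 1 :+ x) :* (con 1 :+ x)) :+ con 2 :* (con 1 :+ x) :* A :+ E))
              :+ con 6 :* ((con 1 :+ m) :* (x :+ l)) :+ con 3 :* ((con 1 :+ m) :* (con 1 :+ m))
           := (con 6 :* E :+ con 6 :* (m :* l) :+ con 3 :* (m :* m)) :+ con 6 :* (con 1 :+ x) :* (con 2 :* A :+ m)
              :+ (con 6 :* ((x :+ (x :+ l)) :* (x :+ (x :+ l))) :+ con 6 :* (m :* ((con 1 :+ x) :* (con 1 :+ x))) :+ con 6 :* x :+ con 6 :* l :+ con 3))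
           refl x l m A E ⟩
    (6 * E + 6 * (m * l) + 3 * (m * m)) + 6 * suc x * (2 * A + m)
      + (6 * (xxl * xxl) + 6 * (m * (suc x * suc x)) + 6 * x + 6 * l + 3)
      -- The cross term between the incremented head `suc x` and the tail sum is what `insSum-sum`,
      -- scaled by 6 (x + 1), evaluates.
      ≡⟨ cong₂ _+_ (cong₂ (λ s t → s + 6 * suc x * t) (insSum-sqSum v) (insSum-sum v)) refl ⟩
    (6 * ((2 + m) * (l * l)) + 6 * (m * m * l) + 12 * M + 6 * q + 2 * (m * (m * m)) + m) + 6 * suc x * (2 * (suc m * l) + m * m)
      + (6 * (xxl * xxl) + 6 * (m * (suc x * suc x)) + 6 * x + 6 * l + 3)
      ≡⟨ solve 5 (λ x l m M q →
              (con 6 :* ((con 2 :+ m) :* (l :* l)) :+ con 6 :* (m :* m :* l) :+ con 12 :* M :+ con 6 :* q :+ con 2 :* (m :* (m :* m)) :+ m)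
              :+ con 6 :* (con 1 :+ x) :* (con 2 :* ((con 1 :+ m) :* l) :+ m :* m)
              :+ (con 6 :* ((x :+ (x :+ l)) :* (x :+ (x :+ l))) :+ con 6 :* (m :* ((con 1 :+ x) :* (con 1 :+ x))) :+ con 6 :* x :+ con 6 :* l :+ con 3)
           := con 6 :* ((con 3 :+ m) :* ((x :+ l) :* (x :+ l))) :+ con 6 :* ((con 1 :+ m) :* (con 1 :+ m) :* (x :+ l))
              :+ con 12 :* (M :+ l) :+ con 6 :* (x :* x :+ q) :+ con 2 :* ((con 1 :+ m) :* ((con 1 :+ m) :* (con 1 :+ m))) :+ (con 1 :+ m))
           refl x l m M q ⟩
    6 * ((3 + m) * ((x + l) * (x + l))) + 6 * (suc m * suc m * (x + l)) + 12 * (M + l) + 6 * (x * x + q)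
      + 2 * (suc m * (suc m * suc m)) + suc m ∎
    where
    open ≡-Reasoning
    open ℕ-Solver
    l = Vec.sum v
    M = moment v
    q = sumSq v
    A = insSum Vec.sum v
    E = insSum sqSum v
    xxl = x + (x + l)
    expand : insSum (λ w → (suc x + Vec.sum w) * (suc x + Vec.sum w)) v ≡ m * (suc x * suc x) + 2 * suc x * A + E
    expand = begin
      insSum (λ w → (suc x + Vec.sum w) * (suc x + Vec.sum w)) v
        ≡⟨ insSum-cong (λ w → solve 2 (λ y s → (y :+ s) :* (y :+ s) := y :* y :+ con 2 :* y :* s :+ s :* s) refl (suc x) (Vec.sum w)) v ⟩
      insSum (λ w → suc x * suc x + 2 * suc x * Vec.sum w + sqSum w) v
        ≡⟨ insSum-+ (λ w → suc x * suc x + 2 * suc x * Vec.sum w) sqSum v ⟩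
      insSum (λ w → suc x * suc x + 2 * suc x * Vec.sum w) v + E
        ≡⟨ cong (_+ E) (insSum-+ (λ _ → suc x * suc x) (λ w → 2 * suc x * Vec.sum w) v) ⟩
      insSum (λ _ → suc x * suc x) v + insSum (λ w → 2 * suc x * Vec.sum w) v + E
        ≡⟨ cong (_+ E) (cong₂ _+_ (insSum-const (suc x * suc x) v) (insSum-* (2 * suc x) Vec.sum v)) ⟩
      m * (suc x * suc x) + 2 * suc x * A + E ∎

open import Data.Integer.Base as ℤ using (+_)
import Data.Integer.Properties as ℤ
open import Data.Rational.Base
import Data.Rational.Properties as ℚ
open import Data.Rational.Solver renaming (module +-*-Solver to ℚ-Solver)
import Data.Rational.Unnormalised.Base as ℚᵘ
import Data.Rational.Unnormalised.Properties as ℚᵘ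
open ℚ-Solver using (Polynomial; solve; con; _:+_; _:*_; _:-_; :-_; _:=_)
open import Algebra.Properties.AbelianGroup ℚ.+-0-abelianGroup using (∙-cancelʳ)

-- Embedding ℕ into ℚ

fromℕ-+ : ∀ a b → fromℕ (a ℕ.+ b) ≡ fromℕ a + fromℕ b
fromℕ-+ a b = ℚ.toℚᵘ-injective (begin
  toℚᵘ (fromℕ (a ℕ.+ b))             ≈⟨ ℚ.toℚᵘ-fromℚᵘ (ℚᵘ.mkℚᵘ (+ (a ℕ.+ b)) 0) ⟩
  ℚᵘ.mkℚᵘ (+ (a ℕ.+ b)) 0            ≈⟨ ℚᵘ.*≡* (cong (ℤ._* + 1) (trans (ℤ.pos-+ a b)
                                          (cong₂ ℤ._+_ (sym (ℤ.*-identityʳ (+ a))) (sym (ℤ.*-identityʳ (+ b)))))) ⟩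
  ℚᵘ.mkℚᵘ (+ a) 0 ℚᵘ.+ ℚᵘ.mkℚᵘ (+ b) 0 ≈⟨ ℚᵘ.+-cong (ℚ.toℚᵘ-fromℚᵘ (ℚᵘ.mkℚᵘ (+ a) 0)) (ℚ.toℚᵘ-fromℚᵘ (ℚᵘ.mkℚᵘ (+ b) 0)) ⟨
  toℚᵘ (fromℕ a) ℚᵘ.+ toℚᵘ (fromℕ b) ≈⟨ ℚ.toℚᵘ-homo-+ (fromℕ a) (fromℕ b) ⟨
  toℚᵘ (fromℕ a + fromℕ b)           ∎)
  where open ℚᵘ.≃-Reasoning

fromℕ-* : ∀ a b → fromℕ (a ℕ.* b) ≡ fromℕ a * fromℕ b
fromℕ-* a b = ℚ.toℚᵘ-injective (begin
  toℚᵘ (fromℕ (a ℕ.* b))             ≈⟨ ℚ.toℚᵘ-fromℚᵘ (ℚᵘ.mkℚᵘ (+ (a ℕ.* b)) 0) ⟩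
  ℚᵘ.mkℚᵘ (+ (a ℕ.* b)) 0            ≈⟨ ℚᵘ.*≡* (cong (ℤ._* + 1) (ℤ.pos-* a b)) ⟩
  ℚᵘ.mkℚᵘ (+ a) 0 ℚᵘ.* ℚᵘ.mkℚᵘ (+ b) 0 ≈⟨ ℚᵘ.*-cong (ℚ.toℚᵘ-fromℚᵘ (ℚᵘ.mkℚᵘ (+ a) 0)) (ℚ.toℚᵘ-fromℚᵘ (ℚᵘ.mkℚᵘ (+ b) 0)) ⟨
  toℚᵘ (fromℕ a) ℚᵘ.* toℚᵘ (fromℕ b) ≈⟨ ℚ.toℚᵘ-homo-* (fromℕ a) (fromℕ b) ⟨
  toℚᵘ (fromℕ a * fromℕ b)           ∎)
  where open ℚᵘ.≃-Reasoning

/-*-fromℕ : ∀ p d .{{_ : ℕ.NonZero d}} → (+ p / d) * fromℕ d ≡ fromℕ p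
/-*-fromℕ p (suc d) = ℚ.toℚᵘ-injective (begin
  toℚᵘ ((+ p / suc d) * fromℕ (suc d))              ≈⟨ ℚ.toℚᵘ-homo-* (+ p / suc d) (fromℕ (suc d)) ⟩
  toℚᵘ (+ p / suc d) ℚᵘ.* toℚᵘ (fromℕ (suc d))      ≈⟨ ℚᵘ.*-cong (ℚ.toℚᵘ-fromℚᵘ (ℚᵘ.mkℚᵘ (+ p) d)) (ℚ.toℚᵘ-fromℚᵘ (ℚᵘ.mkℚᵘ (+ suc d) 0)) ⟩
  ℚᵘ.mkℚᵘ (+ p) d ℚᵘ.* ℚᵘ.mkℚᵘ (+ suc d) 0          ≈⟨ ℚᵘ.*≡* (ℤ.*-assoc (+ p) (+ suc d) (+ 1)) ⟩
  ℚᵘ.mkℚᵘ (+ p) 0                                    ≈⟨ ℚ.toℚᵘ-fromℚᵘ (ℚᵘ.mkℚᵘ (+ p) 0) ⟨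
  toℚᵘ (fromℕ p)                                     ∎)
  where open ℚᵘ.≃-Reasoning

inverse-unique : ∀ {x y} z → x * z ≡ 1ℚ → y * z ≡ 1ℚ → x ≡ y
inverse-unique {x} {y} z xz≡1 yz≡1 = begin
  x           ≡⟨ ℚ.*-identityʳ x ⟨
  x * 1ℚ      ≡⟨ cong (x *_) yz≡1 ⟨
  x * (y * z) ≡⟨ solve 3 (λ x y z → x :* (y :* z) := (x :* z) :* y) refl x y z ⟩
  (x * z) * y ≡⟨ cong (_* y) xz≡1 ⟩
  1ℚ * y      ≡⟨ ℚ.*-identityˡ y ⟩
  y           ∎
  where
  open ≡-Reasoning

-- The uniform weight and linearity of expectation

𝓢-weight : ℕ → ℚ
𝓢-weight n = (+ 1 / length (𝓢 n)) {{𝓢-nonZero n}}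

sum-map-const : ∀ c (xs : List S) → sum (map (λ _ → c) xs) ≡ length xs ℕ.* c
sum-map-const c []       = refl
sum-map-const c (x ∷ xs) = cong (c ℕ.+_) (sum-map-const c xs)

sum-map-𝓢 : ∀ {n} (f : Permutation′ (suc n) → ℕ) →
  sum (map f (𝓢 (suc n))) ≡ sum (map (λ π → sum (map (λ i → f (insert i zero π)) (allFin (suc n)))) (𝓢 n))
sum-map-𝓢 {n} f = sum-map-cartesianProductWith f (λ i π → insert i zero π) (allFin (suc n)) (𝓢 n)

length-𝓢 : ∀ n → length (𝓢 (suc n)) ≡ suc n ℕ.* length (𝓢 n)
length-𝓢 n = begin
  length (𝓢 (suc n))                                 ≡⟨ ℕ.*-identityʳ _ ⟨
  length (𝓢 (suc n)) ℕ.* 1                           ≡⟨ sum-map-const 1 (𝓢 (suc n)) ⟨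
  sum (map (λ _ → 1) (𝓢 (suc n)))                    ≡⟨ sum-map-𝓢 {n} (λ _ → 1) ⟩
  sum (map (λ _ → sum (map (λ _ → 1) is)) (𝓢 n))     ≡⟨ sum-map-const _ (𝓢 n) ⟩
  length (𝓢 n) ℕ.* sum (map (λ _ → 1) is)            ≡⟨ cong (length (𝓢 n) ℕ.*_) (sum-map-const 1 is) ⟩
  length (𝓢 n) ℕ.* (length is ℕ.* 1)                 ≡⟨ cong (length (𝓢 n) ℕ.*_) (ℕ.*-identityʳ _) ⟩
  length (𝓢 n) ℕ.* length is                         ≡⟨ cong (length (𝓢 n) ℕ.*_) (length-tabulate {n = suc n} (λ i → i)) ⟩
  length (𝓢 n) ℕ.* suc n                             ≡⟨ ℕ.*-comm (length (𝓢 n)) (suc n) ⟩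
  suc n ℕ.* length (𝓢 n)                             ∎
  where
  open ≡-Reasoning
  is = allFin (suc n)

𝓢-weight-* : ∀ n → 𝓢-weight n * fromℕ (length (𝓢 n)) ≡ 1ℚ
𝓢-weight-* n = /-*-fromℕ 1 (length (𝓢 n)) {{𝓢-nonZero n}}

𝓢-weight-suc : ∀ n → fromℕ (suc n) * 𝓢-weight (suc n) ≡ 𝓢-weight n
𝓢-weight-suc n = inverse-unique (fromℕ (length (𝓢 n))) (begin
  fromℕ (suc n) * 𝓢-weight (suc n) * fromℕ (length (𝓢 n))
    ≡⟨ solve 3 (λ a w l → a :* w :* l := w :* (a :* l)) refl (fromℕ (suc n)) (𝓢-weight (suc n)) (fromℕ (length (𝓢 n))) ⟩
  𝓢-weight (suc n) * (fromℕ (suc n) * fromℕ (length (𝓢 n)))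
    ≡⟨ cong (𝓢-weight (suc n) *_) (trans (cong fromℕ (length-𝓢 n)) (fromℕ-* (suc n) (length (𝓢 n)))) ⟨
  𝓢-weight (suc n) * fromℕ (length (𝓢 (suc n)))
    ≡⟨ 𝓢-weight-* (suc n) ⟩
  1ℚ ∎) (𝓢-weight-* n)
  where
  open ≡-Reasoning

𝖤-cong : ∀ {n} {Y Z : Permutation′ n → ℚ} → (∀ π → Y π ≡ Z π) → 𝖤 Y ≡ 𝖤 Z
𝖤-cong {n} Y≗Z = cong (foldr _+_ 0ℚ) (map-cong (λ π → cong (_* 𝓢-weight n) (Y≗Z π)) (𝓢 n))

𝖤-+ : ∀ {n} (Y Z : Permutation′ n → ℚ) → 𝖤 (λ π → Y π + Z π) ≡ 𝖤 Y + 𝖤 Z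
𝖤-+ {n} Y Z = go (𝓢 n)
  where
  w = 𝓢-weight n
  go : ∀ πs → foldr _+_ 0ℚ (map (λ π → (Y π + Z π) * w) πs)
            ≡ foldr _+_ 0ℚ (map (λ π → Y π * w) πs) + foldr _+_ 0ℚ (map (λ π → Z π * w) πs)
  go []       = refl
  go (π ∷ πs) = trans (cong (_+_ ((Y π + Z π) * w)) (go πs))
    (solve 5 (λ y z w s t → (y :+ z) :* w :+ (s :+ t) := (y :* w :+ s) :+ (z :* w :+ t)) refl (Y π) (Z π) w _ _)

𝖤-* : ∀ {n} c (Y : Permutation′ n → ℚ) → 𝖤 (λ π → c * Y π) ≡ c * 𝖤 Y
𝖤-* {n} c Y = go (𝓢 n)
  where
  w = 𝓢-weight n
  go : ∀ πs → foldr _+_ 0ℚ (map (λ π → c * Y π * w) πs) ≡ c * foldr _+_ 0ℚ (map (λ π → Y π * w) πs)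
  go []       = sym (ℚ.*-zeroʳ c)
  go (π ∷ πs) = trans (cong (_+_ (c * Y π * w)) (go πs))
    (solve 4 (λ c y w s → c :* y :* w :+ c :* s := c :* (y :* w :+ s)) refl c (Y π) w _)

𝖤-fromℕ : ∀ {n} (f : Permutation′ n → ℕ) → 𝖤 (fromℕ ∘ f) ≡ fromℕ (sum (map f (𝓢 n))) * 𝓢-weight n
𝖤-fromℕ {n} f = go (𝓢 n)
  where
  w = 𝓢-weight n
  go : ∀ πs → foldr _+_ 0ℚ (map (λ π → fromℕ (f π) * w) πs) ≡ fromℕ (sum (map f πs)) * w
  go []       = sym (ℚ.*-zeroˡ w)
  go (π ∷ πs) = begin
    fromℕ (f π) * w + foldr _+_ 0ℚ (map (λ π → fromℕ (f π) * w) πs)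
                                                 ≡⟨ cong (_+_ (fromℕ (f π) * w)) (go πs) ⟩
    fromℕ (f π) * w + fromℕ (sum (map f πs)) * w ≡⟨ ℚ.*-distribʳ-+ w (fromℕ (f π)) _ ⟨
    (fromℕ (f π) + fromℕ (sum (map f πs))) * w   ≡⟨ cong (_* w) (fromℕ-+ (f π) _) ⟨
    fromℕ (f π ℕ.+ sum (map f πs)) * w           ∎
    where open ≡-Reasoning

𝖤-const : ∀ {n} (c : ℕ) → 𝖤 {n} (λ _ → fromℕ c) ≡ fromℕ c
𝖤-const {n} c = begin
  𝖤 {n} (λ _ → fromℕ c)                      ≡⟨ 𝖤-fromℕ {n} (λ _ → c) ⟩
  fromℕ (sum (map (λ _ → c) (𝓢 n))) * w       ≡⟨ cong (λ k → fromℕ k * w) (sum-map-const c (𝓢 n)) ⟩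
  fromℕ (length (𝓢 n) ℕ.* c) * w              ≡⟨ cong (_* w) (fromℕ-* (length (𝓢 n)) c) ⟩
  fromℕ (length (𝓢 n)) * fromℕ c * w          ≡⟨ solve 3 (λ l c w → l :* c :* w := c :* (w :* l)) refl (fromℕ (length (𝓢 n))) (fromℕ c) w ⟩
  fromℕ c * (w * fromℕ (length (𝓢 n)))        ≡⟨ cong (fromℕ c *_) (𝓢-weight-* n) ⟩
  fromℕ c * 1ℚ                                ≡⟨ ℚ.*-identityʳ _ ⟩
  fromℕ c                                     ∎
  where
  open ≡-Reasoning
  w = 𝓢-weight n

-- Means of profile statistics

𝔼 : ∀ n → (Vec ℕ (suc n) → ℕ) → ℚ
𝔼 n g = 𝖤 {n} (fromℕ ∘ g ∘ borderProfile)

𝔼-cong : ∀ {n} {f g : Vec ℕ (suc n) → ℕ} → (∀ v → f v ≡ g v) → 𝔼 n f ≡ 𝔼 n g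
𝔼-cong {n} f≗g = 𝖤-cong {n} (λ π → cong fromℕ (f≗g (borderProfile π)))

𝔼-+ : ∀ {n} (f g : Vec ℕ (suc n) → ℕ) → 𝔼 n (λ v → f v ℕ.+ g v) ≡ 𝔼 n f + 𝔼 n g
𝔼-+ {n} f g = trans (𝖤-cong {n} (λ π → fromℕ-+ (f (borderProfile π)) (g (borderProfile π))))
  (𝖤-+ {n} (fromℕ ∘ f ∘ borderProfile) (fromℕ ∘ g ∘ borderProfile))

𝔼-* : ∀ {n} c (f : Vec ℕ (suc n) → ℕ) → 𝔼 n (λ v → c ℕ.* f v) ≡ fromℕ c * 𝔼 n f
𝔼-* {n} c f = trans (𝖤-cong {n} (λ π → fromℕ-* c (f (borderProfile π))))
  (𝖤-* {n} (fromℕ c) (fromℕ ∘ f ∘ borderProfile))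

-- A record rather than a synonym, so that n and f are recovered by unification.
record HasMean n (f : Vec ℕ (suc n) → ℕ) (a : ℚ) : Set where
  constructor hasMean
  field mean≡ : 𝔼 n f ≡ a

infixl 6 _⊞_
_⊞_ : ∀ {n f g a b} → HasMean n f a → HasMean n g b → HasMean n (λ v → f v ℕ.+ g v) (a + b)
_⊞_ {n} {f} {g} (hasMean p) (hasMean q) = hasMean (trans (𝔼-+ {n} f g) (cong₂ _+_ p q))

infixr 7 _⊡_
_⊡_ : ∀ {n f a} c → HasMean n f a → HasMean n (λ v → c ℕ.* f v) (fromℕ c * a)
_⊡_ {n} {f} c (hasMean p) = hasMean (trans (𝔼-* {n} c f) (cong (fromℕ c *_) p))

constant : ∀ {n} c → HasMean n (λ _ → c) (fromℕ c)
constant {n} c = hasMean (𝖤-const {n} c)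

-- `𝓢 (suc n)` consists of all insertions into `𝓢 n`, so averaging over it means averaging over both
-- the permutation and the n + 1 positions; the factor undoes the average over positions.
𝔼-insSum : ∀ {n} (g : Vec ℕ (2 ℕ.+ n) → ℕ) → 𝔼 n (insSum g) ≡ fromℕ (suc n) * 𝔼 (suc n) g
𝔼-insSum {n} g = sym (begin
  fromℕ (suc n) * 𝔼 (suc n) g
    ≡⟨ cong (fromℕ (suc n) *_) (𝖤-fromℕ {suc n} (g ∘ borderProfile)) ⟩
  fromℕ (suc n) * (fromℕ (sum (map (g ∘ borderProfile) (𝓢 (suc n)))) * 𝓢-weight (suc n))
    ≡⟨ cong (λ t → fromℕ (suc n) * (fromℕ t * 𝓢-weight (suc n))) total≡ ⟩
  fromℕ (suc n) * (fromℕ total * 𝓢-weight (suc n))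
    ≡⟨ solve 3 (λ a t w → a :* (t :* w) := t :* (a :* w)) refl (fromℕ (suc n)) (fromℕ total) (𝓢-weight (suc n)) ⟩
  fromℕ total * (fromℕ (suc n) * 𝓢-weight (suc n))
    ≡⟨ cong (fromℕ total *_) (𝓢-weight-suc n) ⟩
  fromℕ total * 𝓢-weight n
    ≡⟨ 𝖤-fromℕ {n} (insSum g ∘ borderProfile) ⟨
  𝔼 n (insSum g) ∎)
  where
  open ≡-Reasoning
  total = sum (map (insSum g ∘ borderProfile) (𝓢 n))
  total≡ : sum (map (g ∘ borderProfile) (𝓢 (suc n))) ≡ total
  total≡ = trans (sum-map-𝓢 (g ∘ borderProfile)) (cong sum (map-cong (λ π → trans
    (cong sum (map-cong (λ i → cong g (borderProfile-insert i π)) (allFin (suc n))))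
    (sum-ins g (borderProfile π))) (𝓢 n)))

meanOf : ∀ {n} f → HasMean n f (𝔼 n f)
meanOf f = hasMean refl

meanOf-insSum : ∀ {n} f → HasMean n (insSum f) (fromℕ (suc n) * 𝔼 (suc n) f)
meanOf-insSum f = hasMean (𝔼-insSum f)

-- Transfers a pointwise identity in ℕ to the means: each side is built with `⊞`, `⊡` and `constant`
-- following its own syntax.
mean-unique : ∀ {n f g a b} → (∀ v → f v ≡ g v) → HasMean n f a → HasMean n g b → a ≡ b
mean-unique {n} f≗g (hasMean p) (hasMean q) = trans (sym p) (trans (𝔼-cong {n} f≗g) q)

-- Recursions for the four means

module _ (n : ℕ) where
  private
    m = suc n
    N = fromℕ m
    l = 𝔼 n Vec.sum
    M = 𝔼 n moment
    q = 𝔼 n sumSq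
    s = 𝔼 n sqSum

  mean-sum-suc : fromℕ 2 * (N * 𝔼 m Vec.sum) + N ≡ fromℕ 2 * (fromℕ (suc m) * l) + fromℕ (m ℕ.* m)
  mean-sum-suc = mean-unique insSum-sum
    (2 ⊡ meanOf-insSum Vec.sum ⊞ constant m)
    (2 ⊡ suc m ⊡ meanOf Vec.sum ⊞ constant (m ℕ.* m))

  mean-moment-suc : fromℕ 6 * (N * 𝔼 m moment) + fromℕ (3 ℕ.* (m ℕ.* m))
    ≡ fromℕ 6 * (fromℕ (2 ℕ.+ m) * M) + fromℕ 6 * l + fromℕ (m ℕ.* (m ℕ.* m)) + fromℕ (2 ℕ.* m)
  mean-moment-suc = mean-unique insSum-moment
    (6 ⊡ meanOf-insSum moment ⊞ constant (3 ℕ.* (m ℕ.* m)))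
    (6 ⊡ (2 ℕ.+ m) ⊡ meanOf moment ⊞ 6 ⊡ meanOf Vec.sum ⊞ constant (m ℕ.* (m ℕ.* m)) ⊞ constant (2 ℕ.* m))

  mean-sumSq-suc : fromℕ 2 * (N * 𝔼 m sumSq) + fromℕ 4 * M + fromℕ 4 * l + N
    ≡ fromℕ 2 * (fromℕ (suc m) * q) + fromℕ 4 * (N * l) + fromℕ (m ℕ.* m)
  mean-sumSq-suc = mean-unique insSum-sumSq
    (2 ⊡ meanOf-insSum sumSq ⊞ 4 ⊡ meanOf moment ⊞ 4 ⊡ meanOf Vec.sum ⊞ constant m)
    (2 ⊡ suc m ⊡ meanOf sumSq ⊞ 4 ⊡ m ⊡ meanOf Vec.sum ⊞ constant (m ℕ.* m))

  mean-sqSum-suc : fromℕ 6 * (N * 𝔼 m sqSum) + fromℕ 6 * (N * l) + fromℕ (3 ℕ.* (m ℕ.* m))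
    ≡ fromℕ 6 * (fromℕ (2 ℕ.+ m) * s) + fromℕ 6 * (fromℕ (m ℕ.* m) * l) + fromℕ 12 * M + fromℕ 6 * q
      + fromℕ (2 ℕ.* (m ℕ.* (m ℕ.* m))) + N
  mean-sqSum-suc = mean-unique insSum-sqSum
    (6 ⊡ meanOf-insSum sqSum ⊞ 6 ⊡ m ⊡ meanOf Vec.sum ⊞ constant (3 ℕ.* (m ℕ.* m)))
    (6 ⊡ (2 ℕ.+ m) ⊡ meanOf sqSum ⊞ 6 ⊡ (m ℕ.* m) ⊡ meanOf Vec.sum ⊞ 12 ⊡ meanOf moment ⊞ 6 ⊡ meanOf sumSq
      ⊞ constant (2 ℕ.* (m ℕ.* (m ℕ.* m))) ⊞ constant m)

-- Solving the recursions

-- Applied to p = q a linear combination of the hypotheses chosen so that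
-- a - b = p - q is a ring identity.
certify : ∀ {a b p q : ℚ} → p ≡ q → a + q ≡ b + p → a ≡ b
certify {a} {b} {p} refl eq = ∙-cancelʳ p a b eq

*-cancelˡ : ∀ {x y} r {z} → r * z ≡ 1ℚ → r * x ≡ r * y → x ≡ y
*-cancelˡ {x} {y} r {z} rz≡1 rx≡ry = begin
  x             ≡⟨ ℚ.*-identityˡ x ⟨
  1ℚ * x        ≡⟨ cong (_* x) rz≡1 ⟨
  r * z * x     ≡⟨ solve 3 (λ r z x → r :* z :* x := z :* (r :* x)) refl r z x ⟩
  z * (r * x)   ≡⟨ cong (z *_) rx≡ry ⟩
  z * (r * y)   ≡⟨ solve 3 (λ r z y → z :* (r :* y) := r :* z :* y) refl r z y ⟩
  r * z * y     ≡⟨ cong (_* y) rz≡1 ⟩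
  1ℚ * y        ≡⟨ ℚ.*-identityˡ y ⟩
  y             ∎
  where open ≡-Reasoning

infix 9 #_
#_ : ∀ {n} → ℕ → Polynomial n
# k = con (fromℕ k)

-- The closed forms of 2 E(L), 12 E(M), 6 E(Q) and 12 E(L²), scaled to clear
-- denominators, in N = n + 1, h = H n 1 and g = H n 2; the primed versions
-- reflect them into the syntax of the ring solver.
sumForm : ℚ → ℚ → ℚ
sumForm N h = N * N + N - fromℕ 2 - fromℕ 2 * (N * h)

sumForm′ : ∀ {n} → Polynomial n → Polynomial n → Polynomial n
sumForm′ N h = N :* N :+ N :- # 2 :- # 2 :* (N :* h)

momentForm : ℚ → ℚ → ℚ
momentForm N h = fromℕ 2 * (N * (N * N)) + fromℕ 3 * (N * N) - fromℕ 11 * N + fromℕ 6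
  - fromℕ 6 * (N * N * h) + fromℕ 6 * (N * h)

momentForm′ : ∀ {n} → Polynomial n → Polynomial n → Polynomial n
momentForm′ N h = # 2 :* (N :* (N :* N)) :+ # 3 :* (N :* N) :- # 11 :* N :+ # 6 :- # 6 :* (N :* N :* h) :+ # 6 :* (N :* h)

sumSqForm : ℚ → ℚ → ℚ → ℚ
sumSqForm N h g = fromℕ 2 * (N * (N * N)) - fromℕ 2 * N + fromℕ 6 * ((fromℕ 2 - N * N) * h) - fromℕ 6 * (N * g) + fromℕ 6 * (N * (h * h))

sumSqForm′ : ∀ {n} → Polynomial n → Polynomial n → Polynomial n → Polynomial n
sumSqForm′ N h g = # 2 :* (N :* (N :* N)) :- # 2 :* N :+ # 6 :* ((# 2 :- N :* N) :* h) :- # 6 :* (N :* g) :+ # 6 :* (N :* (h :* h))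

-- The first summand is 12 times the claimed variance, since 2n(n+2) = 2N² - 2; the second is 12
-- E(L)².
sqSumForm : ℚ → ℚ → ℚ → ℚ
sqSumForm N h g = fromℕ 12 * (fromℕ 2 * (N * N) - fromℕ 2 - N * h - N * N * g) + fromℕ 3 * (sumForm N h * sumForm N h)

sqSumForm′ : ∀ {n} → Polynomial n → Polynomial n → Polynomial n → Polynomial n
sqSumForm′ N h g = # 12 :* (# 2 :* (N :* N) :- # 2 :- N :* h :- N :* N :* g) :+ # 3 :* (sumForm′ N h :* sumForm′ N h)

sumForm-suc : ∀ N h u l l′ → N * u ≡ 1ℚ → fromℕ 2 * l ≡ sumForm N h →
  fromℕ 2 * (N * l′) + N ≡ fromℕ 2 * ((1ℚ + N) * l) + N * N →
  fromℕ 2 * l′ ≡ sumForm (1ℚ + N) (h + u)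
sumForm-suc N h u l l′ Nu≡1 l≡ rec = *-cancelˡ N Nu≡1 (certify
  -- The multiple of `l≡` eliminates l. The increment u of the harmonic number occurs in N times the
  -- new form only as -2(1 + N)(N u), which fixes the multiple of `Nu≡1`.
  (cong₂ _+_ rec (cong₂ _+_ (cong ((1ℚ + N) *_) l≡) (cong (fromℕ 2 * (1ℚ + N) *_) Nu≡1)))
  (solve 5 (λ N h u l l′ →
    N :* (# 2 :* l′) :+ (# 2 :* ((# 1 :+ N) :* l) :+ N :* N :+ ((# 1 :+ N) :* sumForm′ N h :+ # 2 :* (# 1 :+ N) :* # 1))
    := N :* sumForm′ (# 1 :+ N) (h :+ u) :+ (# 2 :* (N :* l′) :+ N :+ ((# 1 :+ N) :* (# 2 :* l) :+ # 2 :* (# 1 :+ N) :* (N :* u))))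
    refl N h u l l′))

momentForm-suc : ∀ N h u l M M′ → N * u ≡ 1ℚ → fromℕ 2 * l ≡ sumForm N h → fromℕ 12 * M ≡ momentForm N h →
  fromℕ 6 * (N * M′) + fromℕ 3 * (N * N) ≡ fromℕ 6 * ((fromℕ 2 + N) * M) + fromℕ 6 * l + N * (N * N) + fromℕ 2 * N →
  fromℕ 12 * M′ ≡ momentForm (1ℚ + N) (h + u)
momentForm-suc N h u l M M′ Nu≡1 l≡ M≡ rec = *-cancelˡ N Nu≡1 (certify
  (cong₂ _+_ (cong (fromℕ 2 *_) rec) (cong₂ _+_ (cong ((fromℕ 2 + N) *_) M≡) (cong₂ _+_ (cong (fromℕ 6 *_) l≡)
    (cong (fromℕ 6 * (N * (1ℚ + N)) *_) Nu≡1))))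
  (solve 6 (λ N h u l M M′ →
    N :* (# 12 :* M′) :+ (# 2 :* (# 6 :* ((# 2 :+ N) :* M) :+ # 6 :* l :+ N :* (N :* N) :+ # 2 :* N)
      :+ ((# 2 :+ N) :* momentForm′ N h :+ (# 6 :* sumForm′ N h :+ # 6 :* (N :* (# 1 :+ N)) :* # 1)))
    := N :* momentForm′ (# 1 :+ N) (h :+ u) :+ (# 2 :* (# 6 :* (N :* M′) :+ # 3 :* (N :* N))
      :+ ((# 2 :+ N) :* (# 12 :* M) :+ (# 6 :* (# 2 :* l) :+ # 6 :* (N :* (# 1 :+ N)) :* (N :* u)))))
    refl N h u l M M′))

sumSqForm-suc : ∀ N h g u l M q q′ → N * u ≡ 1ℚ →
  fromℕ 2 * l ≡ sumForm N h → fromℕ 12 * M ≡ momentForm N h → fromℕ 6 * q ≡ sumSqForm N h g →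
  fromℕ 2 * (N * q′) + fromℕ 4 * M + fromℕ 4 * l + N ≡ fromℕ 2 * ((1ℚ + N) * q) + fromℕ 4 * (N * l) + N * N →
  fromℕ 6 * q′ ≡ sumSqForm (1ℚ + N) (h + u) (g + u * u)
sumSqForm-suc N h g u l M q q′ Nu≡1 l≡ M≡ q≡ rec = *-cancelˡ N Nu≡1 (certify
  -- The u² coming from g + u² cancels against the one from (h + u)². What is left is linear in u,
  -- and its coefficient, with sign reversed, is the multiplier of `Nu≡1`.
  (cong₂ _+_ (cong (fromℕ 3 *_) rec) (cong₂ _+_ (cong ((1ℚ + N) *_) q≡) (cong₂ _+_ (cong (fromℕ 6 * (N - 1ℚ) *_) l≡)
    (cong₂ _+_ (cong (- 1ℚ *_) M≡)
      (cong ((fromℕ 6 * (N * N + fromℕ 2 * N - 1ℚ) - fromℕ 12 * ((1ℚ + N) * h)) *_) Nu≡1)))))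
  (solve 8 (λ N h g u l M q q′ →
    N :* (# 6 :* q′) :+ (# 3 :* (# 2 :* ((# 1 :+ N) :* q) :+ # 4 :* (N :* l) :+ N :* N)
      :+ ((# 1 :+ N) :* sumSqForm′ N h g :+ (# 6 :* (N :- # 1) :* sumForm′ N h
        :+ ((:- # 1) :* momentForm′ N h
          :+ (# 6 :* (N :* N :+ # 2 :* N :- # 1) :- # 12 :* ((# 1 :+ N) :* h)) :* # 1))))
    := N :* sumSqForm′ (# 1 :+ N) (h :+ u) (g :+ u :* u)
      :+ (# 3 :* (# 2 :* (N :* q′) :+ # 4 :* M :+ # 4 :* l :+ N)
      :+ ((# 1 :+ N) :* (# 6 :* q) :+ (# 6 :* (N :- # 1) :* (# 2 :* l)
        :+ ((:- # 1) :* (# 12 :* M)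
          :+ (# 6 :* (N :* N :+ # 2 :* N :- # 1) :- # 12 :* ((# 1 :+ N) :* h)) :* (N :* u))))))
    refl N h g u l M q q′))

sqSumForm-suc : ∀ N h g u l M q s s′ → N * u ≡ 1ℚ →
  fromℕ 2 * l ≡ sumForm N h → fromℕ 12 * M ≡ momentForm N h →
  fromℕ 6 * q ≡ sumSqForm N h g → fromℕ 12 * s ≡ sqSumForm N h g →
  fromℕ 6 * (N * s′) + fromℕ 6 * (N * l) + fromℕ 3 * (N * N)
    ≡ fromℕ 6 * ((fromℕ 2 + N) * s) + fromℕ 6 * (N * N * l) + fromℕ 12 * M + fromℕ 6 * q + fromℕ 2 * (N * (N * N)) + N →
  fromℕ 12 * s′ ≡ sqSumForm (1ℚ + N) (h + u) (g + u * u)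
sqSumForm-suc N h g u l M q s s′ Nu≡1 l≡ M≡ q≡ s≡ rec = *-cancelˡ N Nu≡1 (certify
  -- Again the u² terms cancel, now between the g-term and the squared `sumForm`; the linear terms
  -- combine to -12(1 + N)(1 + S)(N u), where S is `sumForm (1ℚ + N) h`.
  (cong₂ _+_ (cong (fromℕ 2 *_) rec) (cong₂ _+_ (cong ((fromℕ 2 + N) *_) s≡) (cong₂ _+_ (cong (fromℕ 6 * (N * N - N) *_) l≡)
    (cong₂ _+_ (cong (fromℕ 2 *_) M≡) (cong₂ _+_ (cong (fromℕ 2 *_) q≡)
      (cong (fromℕ 12 * ((1ℚ + N) * (1ℚ + sumForm (1ℚ + N) h)) *_) Nu≡1))))))
  (solve 9 (λ N h g u l M q s s′ →
    N :* (# 12 :* s′) :+ (# 2 :* (# 6 :* ((# 2 :+ N) :* s) :+ # 6 :* (N :* N :* l) :+ # 12 :* M :+ # 6 :* q :+ # 2 :* (N :* (N :* N)) :+ N)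
      :+ ((# 2 :+ N) :* sqSumForm′ N h g :+ (# 6 :* (N :* N :- N) :* sumForm′ N h
        :+ (# 2 :* momentForm′ N h :+ (# 2 :* sumSqForm′ N h g
          :+ # 12 :* ((# 1 :+ N) :* (# 1 :+ sumForm′ (# 1 :+ N) h)) :* # 1)))))
    := N :* sqSumForm′ (# 1 :+ N) (h :+ u) (g :+ u :* u)
      :+ (# 2 :* (# 6 :* (N :* s′) :+ # 6 :* (N :* l) :+ # 3 :* (N :* N))
      :+ ((# 2 :+ N) :* (# 12 :* s) :+ (# 6 :* (N :* N :- N) :* (# 2 :* l)
        :+ (# 2 :* (# 12 :* M) :+ (# 2 :* (# 6 :* q)
          :+ # 12 :* ((# 1 :+ N) :* (# 1 :+ sumForm′ (# 1 :+ N) h)) :* (N :* u)))))))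
    refl N h g u l M q s s′))

fromℕ-sq : ∀ m → fromℕ (m ℕ.* m) ≡ fromℕ m * fromℕ m
fromℕ-sq m = fromℕ-* m m

fromℕ-cube : ∀ m → fromℕ (m ℕ.* (m ℕ.* m)) ≡ fromℕ m * (fromℕ m * fromℕ m)
fromℕ-cube m = trans (fromℕ-* m (m ℕ.* m)) (cong (fromℕ m *_) (fromℕ-sq m))

-- 1/(m + 1), in the form in which H n 1 is extended.
reciprocal : ℕ → ℚ
reciprocal m = (+ 1 / (suc m ℕ.^ 1)) {{ℕ.m^n≢0 (suc m) 1}}

reciprocal-inverse : ∀ n → fromℕ (suc n) * reciprocal n ≡ 1ℚ
reciprocal-inverse n = begin
  fromℕ (suc n) * reciprocal n           ≡⟨ ℚ.*-comm (fromℕ (suc n)) (reciprocal n) ⟩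
  reciprocal n * fromℕ (suc n)           ≡⟨ cong (λ k → reciprocal n * fromℕ k) (ℕ.^-identityʳ (suc n)) ⟨
  reciprocal n * fromℕ (suc n ℕ.^ 1)     ≡⟨ /-*-fromℕ 1 (suc n ℕ.^ 1) {{ℕ.m^n≢0 (suc n) 1}} ⟩
  1ℚ                                     ∎
  where open ≡-Reasoning

-- Writing the new term as a square lets both harmonic numbers grow through the single quantity u
-- with N u = 1.
H₂-suc : ∀ n → H (suc n) 2 ≡ H n 2 + reciprocal n * reciprocal n
H₂-suc n = cong (λ t → H n 2 + t) (inverse-unique (N * N)
  (trans (cong (u₂ *_) (sym (trans (cong fromℕ sq) (fromℕ-sq (suc n)))))
    (/-*-fromℕ 1 (suc n ℕ.^ 2) {{ℕ.m^n≢0 (suc n) 2}}))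
  (trans (solve 2 (λ N u → u :* u :* (N :* N) := (N :* u) :* (N :* u)) refl N u)
    (cong₂ _*_ (reciprocal-inverse n) (reciprocal-inverse n))))
  where
  N = fromℕ (suc n)
  u = reciprocal n
  u₂ = (+ 1 / (suc n ℕ.^ 2)) {{ℕ.m^n≢0 (suc n) 2}}
  sq : suc n ℕ.^ 2 ≡ suc n ℕ.* suc n
  sq = cong (suc n ℕ.*_) (ℕ.*-identityʳ (suc n))

record ClosedForms (n : ℕ) : Set where
  field
    mean-sum    : fromℕ 2 * 𝔼 n Vec.sum ≡ sumForm (fromℕ (suc n)) (H n 1)
    mean-moment : fromℕ 12 * 𝔼 n moment ≡ momentForm (fromℕ (suc n)) (H n 1)
    mean-sumSq  : fromℕ 6 * 𝔼 n sumSq ≡ sumSqForm (fromℕ (suc n)) (H n 1) (H n 2)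
    mean-sqSum  : fromℕ 12 * 𝔼 n sqSum ≡ sqSumForm (fromℕ (suc n)) (H n 1) (H n 2)

open ClosedForms

closedForms : ∀ n → ClosedForms n
-- The empty permutation has profile (0), and all four forms vanish at N = 1, h = g = 0.
closedForms zero = record { mean-sum = refl ; mean-moment = refl ; mean-sumSq = refl ; mean-sqSum = refl }
closedForms (suc n) = record
  -- The ring identities use 1 + N for the next value of N, hence the transport along `N′≡`.
  { mean-sum    = subst (λ N′ → fromℕ 2 * 𝔼 m Vec.sum ≡ sumForm N′ h′) (sym N′≡)
      (sumForm-suc N h u l (𝔼 m Vec.sum) Nu≡1 (mean-sum IH)
        (subst₂ (λ N′ t → fromℕ 2 * (N * 𝔼 m Vec.sum) + N ≡ fromℕ 2 * (N′ * l) + t) N′≡ (fromℕ-sq m)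
          (mean-sum-suc n)))
  ; mean-moment = subst (λ N′ → fromℕ 12 * 𝔼 m moment ≡ momentForm N′ h′) (sym N′≡)
      (momentForm-suc N h u l M (𝔼 m moment) Nu≡1 (mean-sum IH) (mean-moment IH)
        (trans (cong (λ t → fromℕ 6 * (N * 𝔼 m moment) + t) (sym 3N²≡)) (trans (mean-moment-suc n)
          (cong₂ _+_ (cong₂ _+_ (cong (λ N″ → fromℕ 6 * (N″ * M) + fromℕ 6 * l) (fromℕ-+ 2 m))
            (fromℕ-cube m)) (fromℕ-* 2 m)))))
  ; mean-sumSq  = subst₂ (λ N′ g′ → fromℕ 6 * 𝔼 m sumSq ≡ sumSqForm N′ h′ g′) (sym N′≡) (sym (H₂-suc n))
      (sumSqForm-suc N h g u l M q (𝔼 m sumSq) Nu≡1 (mean-sum IH) (mean-moment IH) (mean-sumSq IH)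
        (trans (mean-sumSq-suc n) (cong₂ (λ N′ t → fromℕ 2 * (N′ * q) + fromℕ 4 * (N * l) + t) N′≡ (fromℕ-sq m))))
  ; mean-sqSum  = subst₂ (λ N′ g′ → fromℕ 12 * 𝔼 m sqSum ≡ sqSumForm N′ h′ g′) (sym N′≡) (sym (H₂-suc n))
      (sqSumForm-suc N h g u l M q s (𝔼 m sqSum) Nu≡1 (mean-sum IH) (mean-moment IH) (mean-sumSq IH) (mean-sqSum IH)
        (trans (cong (λ t → fromℕ 6 * (N * 𝔼 m sqSum) + fromℕ 6 * (N * l) + t) (sym 3N²≡))
          (trans (mean-sqSum-suc n) (cong (_+ N) (cong₂ _+_
            (cong₂ (λ N″ t → fromℕ 6 * (N″ * s) + fromℕ 6 * (t * l) + fromℕ 12 * M + fromℕ 6 * q)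
              (fromℕ-+ 2 m) (fromℕ-sq m))
            (trans (fromℕ-* 2 (m ℕ.* (m ℕ.* m))) (cong (fromℕ 2 *_) (fromℕ-cube m))))))))
  }
  where
  m    = suc n
  N    = fromℕ m
  h    = H n 1
  g    = H n 2
  u    = reciprocal n
  h′   = H m 1
  l    = 𝔼 n Vec.sum
  M    = 𝔼 n moment
  q    = 𝔼 n sumSq
  s    = 𝔼 n sqSum
  IH   = closedForms n
  Nu≡1 = reciprocal-inverse n
  N′≡ : fromℕ (suc m) ≡ 1ℚ + N
  N′≡ = fromℕ-+ 1 m
  3N²≡ : fromℕ (3 ℕ.* (m ℕ.* m)) ≡ fromℕ 3 * (N * N)
  3N²≡ = trans (fromℕ-* 3 (m ℕ.* m)) (cong (fromℕ 3 *_) (fromℕ-sq m))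

-- Expectation and variance of the border sum

Var-𝖤 : ∀ {n} (Y : Permutation′ n → ℚ) → Var Y ≡ 𝖤 (λ π → Y π * Y π) - 𝖤 Y * 𝖤 Y
Var-𝖤 {n} Y = begin
  𝖤 (λ π → (Y π - μ) * (Y π - μ))
    -- The trailing factor `1ℚ` exposes the constant μ² as a multiple of 1, so that `𝖤-*` and
    -- `𝖤-const` at 1 apply.
    ≡⟨ 𝖤-cong {n} (λ π → solve 2 (λ y μ → (y :- μ) :* (y :- μ)
         := y :* y :+ (con (- fromℕ 2) :* μ :* y :+ μ :* μ :* con 1ℚ)) refl (Y π) μ) ⟩
  𝖤 (λ π → Y π * Y π + (- fromℕ 2 * μ * Y π + μ * μ * 1ℚ))
    ≡⟨ trans (𝖤-+ {n} (λ π → Y π * Y π) _) (cong (λ t → 𝖤 (λ π → Y π * Y π) + t) (𝖤-+ {n} (λ π → - fromℕ 2 * μ * Y π) (λ _ → μ * μ * 1ℚ))) ⟩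
  s + (𝖤 (λ π → - fromℕ 2 * μ * Y π) + 𝖤 {n} (λ _ → μ * μ * 1ℚ))
    ≡⟨ cong₂ (λ a b → s + (a + b)) (𝖤-* {n} (- fromℕ 2 * μ) Y)
         (trans (𝖤-* {n} (μ * μ) (λ _ → 1ℚ)) (cong (μ * μ *_) (𝖤-const {n} 1))) ⟩
  s + (- fromℕ 2 * μ * μ + μ * μ * 1ℚ)
    ≡⟨ solve 2 (λ s μ → s :+ (con (- fromℕ 2) :* μ :* μ :+ μ :* μ :* con 1ℚ) := s :- μ :* μ) refl s μ ⟩
  s - μ * μ ∎
  where
  open ≡-Reasoning
  μ = 𝖤 Y
  s = 𝖤 (λ π → Y π * Y π)

𝖤-X : ∀ n → 𝖤 (fromℕ ∘ X n) ≡ 𝔼 n Vec.sum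
𝖤-X n = 𝖤-cong {n} (λ π → cong fromℕ (sym (sum-borderProfile π)))

𝖤-X² : ∀ n → 𝖤 (λ π → fromℕ (X n π) * fromℕ (X n π)) ≡ 𝔼 n sqSum
𝖤-X² n = 𝖤-cong {n} (λ π → trans (sym (fromℕ-sq (X n π)))
  (cong (λ t → fromℕ (t ℕ.* t)) (sym (sum-borderProfile π))))

corollary2p3 : (n : ℕ) → 2 ℕ.≤ n →
    (𝖤 (fromℕ ∘ X n) ≡ fromℕ (n ℕ.+ 1) * (+ n / 2 - H n 1) + fromℕ n)
    × (Var (fromℕ ∘ X n) ≡ fromℕ (2 ℕ.* n ℕ.* (n ℕ.+ 2)) - fromℕ (n ℕ.+ 1) * H n 1 - fromℕ ((n ℕ.+ 1) ℕ.^ 2) * H n 2)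
corollary2p3 n _ = expectation , variance
  where
  open ≡-Reasoning
  ν = fromℕ n
  h = H n 1
  g = H n 2
  l = 𝔼 n Vec.sum
  s = 𝔼 n sqSum

  n+k≡ : ∀ k → fromℕ (n ℕ.+ k) ≡ ν + fromℕ k
  n+k≡ = fromℕ-+ n

  l≡ : fromℕ 2 * l ≡ sumForm (1ℚ + ν) h
  l≡ = trans (mean-sum (closedForms n)) (cong (λ N → sumForm N h) (fromℕ-+ 1 n))

  s≡ : fromℕ 12 * s ≡ sqSumForm (1ℚ + ν) h g
  s≡ = trans (mean-sqSum (closedForms n)) (cong (λ N → sqSumForm N h g) (fromℕ-+ 1 n))

  expectation : 𝖤 (fromℕ ∘ X n) ≡ fromℕ (n ℕ.+ 1) * (+ n / 2 - h) + ν
  expectation = begin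
    𝖤 (fromℕ ∘ X n)                        ≡⟨ 𝖤-X n ⟩
    l                                      ≡⟨ *-cancelˡ (fromℕ 2) {½} refl (certify
      (cong₂ _+_ l≡ (cong ((1ℚ + ν) *_) (sym (/-*-fromℕ n 2))))
      (solve 4 (λ ν h l ½n →
        # 2 :* l :+ (sumForm′ (# 1 :+ ν) h :+ (# 1 :+ ν) :* (½n :* # 2))
        := # 2 :* ((ν :+ # 1) :* (½n :- h) :+ ν) :+ (# 2 :* l :+ (# 1 :+ ν) :* ν)) refl ν h l (+ n / 2))) ⟩
    (ν + 1ℚ) * (+ n / 2 - h) + ν           ≡⟨ cong (λ N → N * (+ n / 2 - h) + ν) (n+k≡ 1) ⟨
    fromℕ (n ℕ.+ 1) * (+ n / 2 - h) + ν    ∎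

  2n[n+2]≡ : fromℕ (2 ℕ.* n ℕ.* (n ℕ.+ 2)) ≡ fromℕ 2 * ν * (ν + fromℕ 2)
  2n[n+2]≡ = trans (fromℕ-* (2 ℕ.* n) (n ℕ.+ 2)) (cong₂ _*_ (fromℕ-* 2 n) (n+k≡ 2))

  [n+1]²≡ : fromℕ ((n ℕ.+ 1) ℕ.^ 2) ≡ (ν + 1ℚ) * (ν + 1ℚ)
  [n+1]²≡ = trans (cong (λ t → fromℕ ((n ℕ.+ 1) ℕ.* t)) (ℕ.*-identityʳ (n ℕ.+ 1)))
    (trans (fromℕ-sq (n ℕ.+ 1)) (cong₂ _*_ (n+k≡ 1) (n+k≡ 1)))

  variance : Var (fromℕ ∘ X n) ≡ fromℕ (2 ℕ.* n ℕ.* (n ℕ.+ 2)) - fromℕ (n ℕ.+ 1) * h - fromℕ ((n ℕ.+ 1) ℕ.^ 2) * g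
  variance = begin
    Var (fromℕ ∘ X n)
      ≡⟨ Var-𝖤 {n} (fromℕ ∘ X n) ⟩
    𝖤 (λ π → fromℕ (X n π) * fromℕ (X n π)) - 𝖤 (fromℕ ∘ X n) * 𝖤 (fromℕ ∘ X n)
      ≡⟨ cong₂ (λ a b → a - b * b) (𝖤-X² n) (𝖤-X n) ⟩
    s - l * l
      -- Since 12 E(L)² = 3 (2 E(L))², subtracting removes the squared `sumForm` and leaves 12 times
      -- the variance.
      ≡⟨ *-cancelˡ (fromℕ 12) {+ 1 / 12} refl (certify
        (cong₂ (λ a b → a - fromℕ 3 * (b * b)) s≡ l≡)
        (solve 5 (λ ν h g l s →
          # 12 :* (s :- l :* l) :+ (sqSumForm′ (# 1 :+ ν) h g :- # 3 :* (sumForm′ (# 1 :+ ν) h :* sumForm′ (# 1 :+ ν) h))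
          := # 12 :* (# 2 :* ν :* (ν :+ # 2) :- (ν :+ # 1) :* h :- (ν :+ # 1) :* (ν :+ # 1) :* g)
             :+ (# 12 :* s :- # 3 :* ((# 2 :* l) :* (# 2 :* l)))) refl ν h g l s)) ⟩
    fromℕ 2 * ν * (ν + fromℕ 2) - (ν + 1ℚ) * h - (ν + 1ℚ) * (ν + 1ℚ) * g
      ≡⟨ cong₂ _-_ (cong₂ (λ a b → a - b * h) 2n[n+2]≡ (n+k≡ 1)) (cong (_* g) [n+1]²≡) ⟨
    fromℕ (2 ℕ.* n ℕ.* (n ℕ.+ 2)) - fromℕ (n ℕ.+ 1) * h - fromℕ ((n ℕ.+ 1) ℕ.^ 2) * g ∎
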